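{- Let $k$ be a positive integer. If $E$ is a subset of $\mathbb{F}_q$ with size $|E|>\dfrac{qk}{\sqrt{q-1}}$, then it contains at least two distinct elements whose difference is a $k$-th power. Thus, in particular, if $k$ is fixed and $|E|=\Omega\left(\sqrt{q}\right)$ as $q\to\infty$, then $E$ contains at least two distinct elements whose difference is a $k$-th power.
   Context: Here $\mathbb{F}_q$ denotes the finite field with $q$ elements, and a $k$-th power means an element of the form $\alpha^k$ with $\alpha\in\mathbb{F}_q$.
   Formalization: The Ω(√q) clause is proved for |E| ≥ C√q with a constant C > k and q large in terms of k and C; for an arbitrary implied constant it is false (k = 2, q = p², E = g·F_p with p odd and g a nonsquare). -}

module Defs where

open import Algebra.Apartness.Bundles using (HeytingField)
open import Algebra.Bundles using (CommutativeRing)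
import Algebra.Properties.Semiring.Exp as Exp
open import Data.Fin.Base using (Fin)
open import Data.Fin.Subset using (Subset) renaming (_∈_ to _∈ₛ_)
open import Data.Integer.Base using (+_)
open import Data.Nat.Base as ℕ using (ℕ)
open import Data.Product.Base using (∃-syntax; _×_)
open import Data.Rational.Base as ℚ using (ℚ; _/_)
open import Function.Bundles using (Inverse)
open import Level using (Level; _⊔_; suc)
import Relation.Binary.PropositionalEquality.Properties as ≡
open import Relation.Nullary.Negation using (¬_)

-- 0 and 1 are distinct in any Heyting field: 0# cannot be invertible, since
-- `invertible⇒#` would give x # x.  Hence q ≥ 2 automatically.
record FiniteField (c ℓ₁ ℓ₂ : Level) : Set (suc (c ⊔ ℓ₁ ⊔ ℓ₂)) where
  field
    heytingField : HeytingField c ℓ₁ ℓ₂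

  open HeytingField heytingField public

  commutativeRing : CommutativeRing c ℓ₁
  commutativeRing = record { isCommutativeRing = isCommutativeRing }

  open Exp (CommutativeRing.semiring commutativeRing) public using (_^_)

  field
    q           : ℕ
    enumeration : Inverse (≡.setoid (Fin q)) setoid

  -- A subset of the field is given by the set of indices of its elements, so
  -- its cardinality is the library's ∣_∣ on `Subset q`.
  infix 4 _∈_
  _∈_ : Carrier → Subset q → Set
  x ∈ E = Inverse.from enumeration x ∈ₛ E

  IsPower : ℕ → Carrier → Set (c ⊔ ℓ₁)
  IsPower k x = ∃[ α ] x ≈ α ^ k

  HasPowerDifference : ℕ → Subset q → Set (c ⊔ ℓ₁)
  HasPowerDifference k E =
    ∃[ x ] ∃[ y ] x ∈ E × y ∈ E × ¬ (x ≈ y) × IsPower k (x - y)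

-- n > a / √m over the reals, for m > 0: both sides are nonnegative, so the
-- inequality is squared and the denominator cleared.
infix 4 _>_/√_
_>_/√_ : ℕ → ℕ → ℕ → Set
n > a /√ m = a ℕ.^ 2 ℕ.< n ℕ.^ 2 ℕ.* m

fromℕ : ℕ → ℚ
fromℕ n = + n / 1

-- n ≥ C √m over the reals, for C ≥ 0, again squared.  For a fixed C this is the
-- hypothesis |E| = Ω(√q) with its implied constant made explicit.  That constant
-- cannot be arbitrary: for k = 2, q = p² with p odd and a nonsquare g of 𝔽_q, the
-- set g·𝔽ₚ has √q elements and none of its nonzero differences is a square.  Any
-- C > k is large enough, since qk / √(q-1) ∼ k √q as q → ∞.
infix 4 _≥_√_
_≥_√_ : ℕ → ℚ → ℕ → Set
n ≥ C √ m = (C ℚ.* C) ℚ.* fromℕ m ℚ.≤ fromℕ (n ℕ.^ 2)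

{-# OPTIONS --safe #-}
-- A second-moment argument replaces the character sums.  Let H be the group of
-- nonzero k-th powers, f = q·1_E − |E|, N = Σ f(x)², and for c in the field
-- A_c f(x) = Σ_{h ∈ H} f(x + ch).  Since f has sum 0, the autocorrelations of f
-- along c(h′ − h) with h ≠ h′ cancel when summed over c, so Σ_c ‖A_c f‖² = q|H|N.
-- The term c = 0 is |H|²N and the |H| terms with c ∈ H are all equal to ‖A_1 f‖²,
-- whence ‖A_1 f‖² ≤ (q − |H|)N ≤ (q − 1)N.  If no difference of E lies in H, then
-- A_1 f = −|E||H| on E, and since N ≤ q²|E| this gives |E|²|H|² ≤ (q − 1)q².
-- Finally q − 1 ≤ k|H|, because X^k − h has at most k roots.
module Submission where

open import Defs
open import Algebra.Bundles using (CommutativeRing; RawRing)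
import Algebra.Morphism.RingMonomorphism as RingMonomorphism
open import Algebra.Morphism.Structures using (IsRingMonomorphism)
import Algebra.Properties.CommutativeSemiring.Exp as Exp
import Algebra.Properties.Ring as RingProperties
import Algebra.Properties.Semiring.Sum as Sum
import Algebra.Solver.Ring.NaturalCoefficients.Default as SemiringSolver
open import Algebra.Structures using (IsCommutativeRing)
open import Data.Bool.Base using (if_then_else_)
open import Data.Fin.Base using (Fin; zero; suc)
open import Data.Fin.Permutation using (Permutation; permutation)
open import Data.Fin.Properties using (_≟_; any?; nonZeroIndex)
open import Data.Fin.Subset using (Subset; ∣_∣; inside; outside; _∉_) renaming (_∈_ to _∈ₛ_)
open import Data.Fin.Subset.Properties using (_∈?_)
open import Data.Integer.Base as ℤ using (ℤ; +_; -[1+_]; 0ℤ; 1ℤ; nonNegative; positive)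
import Data.Integer.Properties as ℤₚ
open import Data.Nat.Base as ℕ using (ℕ; zero; suc; NonZero)
import Data.Nat.Properties as ℕₚ
import Data.Nat.Tactic.RingSolver as ℕSolver
open import Data.Product.Base using (_×_; _,_; ∃-syntax; proj₁; proj₂)
open import Data.Rational.Base as ℚ using (ℚ; mkℚ)
import Data.Rational.Properties as ℚₚ
open import Data.Rational.Unnormalised.Base using (mkℚᵘ)
import Data.Rational.Unnormalised.Properties as ℚᵘₚ
open import Data.Vec.Base using (Vec; []; _∷_; replicate)
open import Function.Base using (_∘_)
open import Function.Bundles using (Inverse)
open import Level using (0ℓ)
open import Relation.Binary.PropositionalEquality as ≡
  using (_≡_; _≢_; cong; cong₂; subst; subst₂; module ≡-Reasoning)
open import Relation.Nullary.Decidable using (Dec; yes; no; does; ¬?; _×-dec_)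
open import Relation.Nullary.Negation using (¬_; contradiction)
open import Relation.Unary using (Decidable)

module FieldsOnFin where
  open import Data.Integer.Base using (_+_; _*_; -_; _-_; _≤_; +≤+)
  open import Data.Integer.Tactic.RingSolver using (solve-∀)
  open ≡ using (refl; sym; trans)
  open Sum ℤₚ.+-*-semiring using (sum; sum-syntax; sum-cong-≗; ∑-distrib-+; ∑-comm; ∑-permute;
    *-distribˡ-sum; *-distribʳ-sum)

  -- Iverson brackets and finite sums of integers.

  private
    variable
      n : ℕ
      A B : Set

  -- The Iverson bracket, valued in ℤ because functions of mean zero take negative values. Being
  -- defined through `does`, it computes even when the proof inside the decision is stuck.
  ⟦_⟧ : Dec A → ℤ
  ⟦ d ⟧ = if does d then 1ℤ else 0ℤ

  ⟦⟧-true : (d : Dec A) → A → ⟦ d ⟧ ≡ 1ℤ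
  ⟦⟧-true (yes _) _ = refl
  ⟦⟧-true (no ¬p) p = contradiction p ¬p

  ⟦⟧-false : (d : Dec A) → ¬ A → ⟦ d ⟧ ≡ 0ℤ
  ⟦⟧-false (yes p) ¬p = contradiction p ¬p
  ⟦⟧-false (no _)  _  = refl

  ⟦⟧-cong : (d : Dec A) (e : Dec B) → (A → B) → (B → A) → ⟦ d ⟧ ≡ ⟦ e ⟧
  ⟦⟧-cong (yes p) e f _ = sym (⟦⟧-true e (f p))
  ⟦⟧-cong (no ¬p) e _ g = sym (⟦⟧-false e (¬p ∘ g))

  ⟦⟧-idem : (d : Dec A) → ⟦ d ⟧ * ⟦ d ⟧ ≡ ⟦ d ⟧
  ⟦⟧-idem (yes _) = refl
  ⟦⟧-idem (no _)  = refl

  ⟦⟧-nonNeg : (d : Dec A) → 0ℤ ≤ ⟦ d ⟧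
  ⟦⟧-nonNeg (yes _) = +≤+ ℕ.z≤n
  ⟦⟧-nonNeg (no _)  = +≤+ ℕ.z≤n

  square-nonNeg : ∀ i → 0ℤ ≤ i * i
  square-nonNeg (+ n)    = subst (0ℤ ≤_) (ℤₚ.pos-* n n) (+≤+ ℕ.z≤n)
  square-nonNeg -[1+ n ] = +≤+ ℕ.z≤n

  *-nonNeg : ∀ {i j} → 0ℤ ≤ i → 0ℤ ≤ j → 0ℤ ≤ i * j
  *-nonNeg {i} {j} 0≤i 0≤j =
    subst (_≤ i * j) (ℤₚ.*-zeroʳ i) (ℤₚ.*-monoˡ-≤-nonNeg i ⦃ nonNegative 0≤i ⦄ 0≤j)

  sum-mono : {f g : Fin n → ℤ} → (∀ i → f i ≤ g i) → sum f ≤ sum g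
  sum-mono {zero}  f≤g = ℤₚ.≤-refl
  sum-mono {suc n} f≤g = ℤₚ.+-mono-≤ (f≤g zero) (sum-mono (f≤g ∘ suc))

  sum-const : ∀ n c → ∑[ i < n ] c ≡ + n * c
  sum-const zero    c = sym (ℤₚ.*-zeroˡ c)
  sum-const (suc n) c = begin
    c + ∑[ i < n ] c  ≡⟨ cong (_+_ c) (sum-const n c) ⟩
    c + + n * c       ≡⟨ lemma c (+ n) ⟩
    (1ℤ + + n) * c    ∎
    where
    open ≡-Reasoning
    lemma : ∀ c m → c + m * c ≡ (1ℤ + m) * c
    lemma = solve-∀

  sum-zero : {f : Fin n → ℤ} → (∀ i → f i ≡ 0ℤ) → sum f ≡ 0ℤ
  sum-zero {n} f≡0 = trans (sum-cong-≗ f≡0) (trans (sum-const n 0ℤ) (ℤₚ.*-zeroʳ (+ n)))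

  sum-nonNeg : {f : Fin n → ℤ} → (∀ i → 0ℤ ≤ f i) → 0ℤ ≤ sum f
  sum-nonNeg {n} {f} 0≤f = subst (_≤ sum f) (sum-zero {n} λ _ → refl) (sum-mono 0≤f)

  term≤sum : {f : Fin n → ℤ} → (∀ i → 0ℤ ≤ f i) → ∀ i → f i ≤ sum f
  term≤sum 0≤f zero    = ℤₚ.i≤i+j _ _ ⦃ nonNegative (sum-nonNeg (0≤f ∘ suc)) ⦄
  term≤sum 0≤f (suc i) =
    ℤₚ.i≤j⇒i≤k+j _ ⦃ nonNegative (0≤f zero) ⦄ (term≤sum (0≤f ∘ suc) i)

  -- Since the bracket looks only at `does`, `⟦ suc i ≟ suc j ⟧` computes to `⟦ i ≟ j ⟧`, which
  -- drives the induction. Read backwards, the identity inserts a sum over the possible values of a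
  -- function.
  sum-δ : (i : Fin n) (g : Fin n → ℤ) → ∑[ j < n ] (⟦ i ≟ j ⟧ * g j) ≡ g i
  sum-δ zero    g = trans (cong₂ _+_ (ℤₚ.*-identityˡ (g zero)) (sum-zero {_} λ j → ℤₚ.*-zeroˡ (g (suc j))))
                          (ℤₚ.+-identityʳ (g zero))
  sum-δ (suc i) g = trans (cong₂ _+_ (ℤₚ.*-zeroˡ (g zero)) (sum-δ i (g ∘ suc)))
                          (ℤₚ.+-identityˡ (g (suc i)))

  sum-∈ : (E : Subset n) → ∑[ x < n ] ⟦ x ∈? E ⟧ ≡ + ∣ E ∣
  sum-∈ []            = refl
  sum-∈ (inside ∷ E)  = cong (_+_ 1ℤ) (sum-∈ E)
  sum-∈ (outside ∷ E) = trans (ℤₚ.+-identityˡ _) (sum-∈ E)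

  -- Field structures on `Fin q`, where equality is decidable and sums over the field are sums over
  -- indices.

  record FinField (q : ℕ) : Set where
    infixl 6 _⊕_
    infixl 7 _⊗_
    infix  8 ⊖_
    field
      _⊕_ _⊗_           : Fin q → Fin q → Fin q
      ⊖_                : Fin q → Fin q
      𝟘 𝟙               : Fin q
      isCommutativeRing : IsCommutativeRing _≡_ _⊕_ _⊗_ ⊖_ 𝟘 𝟙
      𝟙≢𝟘               : 𝟙 ≢ 𝟘
      inverse           : ∀ {x} → x ≢ 𝟘 → ∃[ y ] x ⊗ y ≡ 𝟙

    commutativeRing : CommutativeRing 0ℓ 0ℓ
    commutativeRing = record { isCommutativeRing = isCommutativeRing }

    open CommutativeRing commutativeRing public using (ring; commutativeSemiring;
      +-assoc; +-comm; +-identityˡ; +-identityʳ; zeroˡ; zeroʳ; *-comm; *-assoc; *-identityˡ; *-identityʳ)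
    open Exp commutativeSemiring public using (_^_; ^-distrib-*)

  module _ {q : ℕ} (F : FinField q) where
    open FinField F
    module Solver = SemiringSolver commutativeSemiring

    ⊕⊖-cancel : ∀ x y → (x ⊕ y) ⊕ ⊖ x ≡ y
    ⊕⊖-cancel = RingProperties.xyx⁻¹≈y ring

    ⊖-cancel : ∀ x y → x ⊕ (y ⊕ ⊖ x) ≡ y
    ⊖-cancel x y = trans (sym (+-assoc x y (⊖ x))) (⊕⊖-cancel x y)

    ⊖≡𝟘⇒≡ : ∀ {x y} → x ⊕ ⊖ y ≡ 𝟘 → x ≡ y
    ⊖≡𝟘⇒≡ {x} {y} = RingProperties.x∙y⁻¹≈ε⇒x≈y ring x y

    ⊗-cancel : ∀ {x y} → x ≢ 𝟘 → x ⊗ y ≡ 𝟘 → y ≡ 𝟘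
    ⊗-cancel {x} {y} x≢𝟘 xy≡𝟘 = let z , xz≡𝟙 = inverse x≢𝟘 in begin
      y            ≡⟨ *-identityˡ y ⟨
      𝟙 ⊗ y        ≡⟨ cong (_⊗ y) xz≡𝟙 ⟨
      x ⊗ z ⊗ y    ≡⟨ cong (_⊗ y) (*-comm x z) ⟩
      z ⊗ x ⊗ y    ≡⟨ *-assoc z x y ⟩
      z ⊗ (x ⊗ y)  ≡⟨ cong (z ⊗_) xy≡𝟘 ⟩
      z ⊗ 𝟘        ≡⟨ zeroʳ z ⟩
      𝟘            ∎
      where open ≡-Reasoning

    ⊗-nonzero : ∀ {x y} → x ≢ 𝟘 → y ≢ 𝟘 → x ⊗ y ≢ 𝟘
    ⊗-nonzero x≢𝟘 y≢𝟘 = y≢𝟘 ∘ ⊗-cancel x≢𝟘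

    ^-nonzero : ∀ {x} k → x ≢ 𝟘 → x ^ k ≢ 𝟘
    ^-nonzero zero    x≢𝟘 = 𝟙≢𝟘
    ^-nonzero (suc k) x≢𝟘 = ⊗-nonzero x≢𝟘 (^-nonzero k x≢𝟘)

    translate : Fin q → Permutation q q
    translate t = permutation (t ⊕_) (_⊕ ⊖ t) (⊖-cancel t) (⊕⊖-cancel t)

    scale : ∀ {d} → d ≢ 𝟘 → Permutation q q
    scale {d} d≢𝟘 = permutation (_⊗ d) (_⊗ d⁻¹)
      (λ x → trans (*-assoc x d⁻¹ d) (trans (cong (x ⊗_) (trans (*-comm d⁻¹ d) dd⁻¹≡𝟙)) (*-identityʳ x)))
      (λ x → trans (*-assoc x d d⁻¹) (trans (cong (x ⊗_) dd⁻¹≡𝟙) (*-identityʳ x)))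
      where
      d⁻¹ = proj₁ (inverse d≢𝟘)
      dd⁻¹≡𝟙 = proj₂ (inverse d≢𝟘)

    sum-translate : ∀ f t → ∑[ x < q ] f (t ⊕ x) ≡ sum f
    sum-translate f t = sym (∑-permute f (translate t))

    sum-scale : ∀ f {d} → d ≢ 𝟘 → ∑[ x < q ] f (x ⊗ d) ≡ sum f
    sum-scale f d≢𝟘 = sym (∑-permute f (scale d≢𝟘))

    -- Monic polynomials and the number of their roots.

    -- A list of n coefficients, lowest degree first, stands for the monic
    -- polynomial of degree n with these lower coefficients.
    eval : Vec (Fin q) n → Fin q → Fin q
    eval []       x = 𝟙
    eval (c ∷ cs) x = c ⊕ x ⊗ eval cs x

    -- Synthetic division by X - b: the coefficients of the quotient are the values at `b` of the
    -- successive Horner tails.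
    quotient : Vec (Fin q) (suc n) → Fin q → Vec (Fin q) n
    quotient (c ∷ [])         b = []
    quotient (c ∷ cs@(_ ∷ _)) b = eval cs b ∷ quotient cs b

    -- Division with remainder by X − b, at the point b + d so as to be a
    -- semiring identity.
    eval-quotient : (cs : Vec (Fin q) (suc n)) → ∀ b d →
      eval cs (b ⊕ d) ≡ d ⊗ eval (quotient cs b) (b ⊕ d) ⊕ eval cs b
    eval-quotient (c ∷ []) b d =
      solve 3 (λ c b d → c :+ (b :+ d) :* con 1 := d :* con 1 :+ (c :+ b :* con 1)) refl c b d
      where open Solver
    eval-quotient (c ∷ cs@(_ ∷ _)) b d = begin
      c ⊕ x ⊗ eval cs x              ≡⟨ cong (λ p → c ⊕ x ⊗ p) (eval-quotient cs b d) ⟩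
      c ⊕ x ⊗ (d ⊗ s ⊕ p)            ≡⟨ solve 5 (λ c b d s p →
        c :+ (b :+ d) :* (d :* s :+ p) := d :* (p :+ (b :+ d) :* s) :+ (c :+ b :* p)) refl c b d s p ⟩
      d ⊗ (p ⊕ x ⊗ s) ⊕ (c ⊕ b ⊗ p)  ∎
      where
      open Solver
      open ≡-Reasoning
      x = b ⊕ d
      s = eval (quotient cs b) x
      p = eval cs b

    -- At a root `b` the remainder vanishes, and the factor x - b is nonzero, so it cancels.
    quotient-root : ∀ (cs : Vec (Fin q) (suc n)) {b x} → b ≢ x →
      eval cs b ≡ 𝟘 → eval cs x ≡ 𝟘 → eval (quotient cs b) x ≡ 𝟘
    quotient-root cs {b} {x} b≢x b-root x-root = ⊗-cancel (b≢x ∘ sym ∘ ⊖≡𝟘⇒≡) (begin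
      d ⊗ eval (quotient cs b) x                    ≡⟨ +-identityʳ _ ⟨
      d ⊗ eval (quotient cs b) x ⊕ 𝟘                ≡⟨ cong (d ⊗ eval (quotient cs b) x ⊕_) b-root ⟨
      d ⊗ eval (quotient cs b) x ⊕ eval cs b        ≡⟨ cong (λ y → d ⊗ eval (quotient cs b) y ⊕ eval cs b) (⊖-cancel b x) ⟨
      d ⊗ eval (quotient cs b) (b ⊕ d) ⊕ eval cs b  ≡⟨ eval-quotient cs b d ⟨
      eval cs (b ⊕ d)                               ≡⟨ cong (eval cs) (⊖-cancel b x) ⟩
      eval cs x                                     ≡⟨ x-root ⟩
      𝟘                                             ∎)
      where
      open ≡-Reasoning
      d = x ⊕ ⊖ b

    -- Induction on the degree: once a root `b` is found, every other root is a root of the quotient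
    -- by X - b.
    ∑roots≤degree : (cs : Vec (Fin q) n) → ∑[ x < q ] ⟦ eval cs x ≟ 𝟘 ⟧ ≤ + n
    ∑roots≤degree [] = ℤₚ.≤-reflexive (sum-zero {q} λ x → ⟦⟧-false (𝟙 ≟ 𝟘) 𝟙≢𝟘)
    ∑roots≤degree {suc n} cs@(_ ∷ _) with any? (λ x → eval cs x ≟ 𝟘)
    ... | no  rootless = ℤₚ.≤-trans
      (ℤₚ.≤-reflexive (sum-zero {q} λ x → ⟦⟧-false (eval cs x ≟ 𝟘) λ root → rootless (x , root)))
      (+≤+ ℕ.z≤n)
    ... | yes (b , root) = begin
      ∑[ x < q ] ⟦ eval cs x ≟ 𝟘 ⟧
        ≤⟨ sum-mono root-bound ⟩
      -- The factor `1ℤ` gives the first term the shape that `sum-δ` evaluates.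
      ∑[ x < q ] (⟦ b ≟ x ⟧ * 1ℤ + ⟦ eval cs′ x ≟ 𝟘 ⟧)
        ≡⟨ ∑-distrib-+ _ (λ x → ⟦ eval cs′ x ≟ 𝟘 ⟧) ⟩
      ∑[ x < q ] (⟦ b ≟ x ⟧ * 1ℤ) + ∑[ x < q ] ⟦ eval cs′ x ≟ 𝟘 ⟧
        ≤⟨ ℤₚ.+-mono-≤ (ℤₚ.≤-reflexive (sum-δ b λ _ → 1ℤ)) (∑roots≤degree cs′) ⟩
      1ℤ + + n ∎
      where
      open ℤₚ.≤-Reasoning
      cs′ = quotient cs b

      root-bound : ∀ x → ⟦ eval cs x ≟ 𝟘 ⟧ ≤ ⟦ b ≟ x ⟧ * 1ℤ + ⟦ eval cs′ x ≟ 𝟘 ⟧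
      root-bound x with b ≟ x | eval cs x ≟ 𝟘
      ... | yes _  | yes _  = ℤₚ.i≤i+j 1ℤ _ ⦃ nonNegative (⟦⟧-nonNeg (eval cs′ x ≟ 𝟘)) ⦄
      ... | yes _  | no _   = ℤₚ.≤-trans (⟦⟧-nonNeg (eval cs′ x ≟ 𝟘)) (ℤₚ.i≤j+i _ 1ℤ)
      ... | no _   | no _   = ℤₚ.≤-trans (⟦⟧-nonNeg (eval cs′ x ≟ 𝟘)) (ℤₚ.i≤j+i _ 0ℤ)
      ... | no b≢x | yes x-root = ℤₚ.≤-reflexive (sym (trans (ℤₚ.+-identityˡ _)
        (⟦⟧-true (eval cs′ x ≟ 𝟘) (quotient-root cs b≢x root x-root))))

    eval-replicate : ∀ n x → eval (replicate n 𝟘) x ≡ x ^ n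
    eval-replicate zero    x = refl
    eval-replicate (suc n) x = trans (+-identityˡ _) (cong (x ⊗_) (eval-replicate n x))

    -- The solutions are the roots of X^k - h, which is monic of degree k because k is positive.
    ∑[^≡]≤ : ∀ k .{{_ : NonZero k}} h → ∑[ x < q ] ⟦ x ^ k ≟ h ⟧ ≤ + k
    ∑[^≡]≤ (suc k) h = subst (_≤ + suc k)
      (sum-cong-≗ λ x → ⟦⟧-cong (eval p x ≟ 𝟘) (x ^ suc k ≟ h)
        (λ eq → ⊖≡𝟘⇒≡ (trans (sym (eval-p x)) eq))
        (λ eq → trans (eval-p x) (RingProperties.x≈y⇒x∙y⁻¹≈ε ring eq)))
      (∑roots≤degree p)
      where
      p = ⊖ h ∷ replicate k 𝟘
      eval-p : ∀ x → eval p x ≡ x ^ suc k ⊕ ⊖ h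
      eval-p x = trans (cong (λ y → ⊖ h ⊕ x ⊗ y) (eval-replicate k x))
        (+-comm (⊖ h) (x ^ suc k))

  -- Rearrangement of multiple sums.

  sum-rotate : ∀ {l m n} (g : Fin l → Fin m → Fin n → ℤ) →
    ∑[ i < l ] ∑[ j < m ] ∑[ k < n ] g i j k ≡ ∑[ k < n ] ∑[ i < l ] ∑[ j < m ] g i j k
  sum-rotate {l} {m} g = trans (sum-cong-≗ {l} λ i → ∑-comm (g i)) (∑-comm λ i k → ∑[ j < m ] g i j k)

  sum*sum : ∀ {m n} (f : Fin m → ℤ) (g : Fin n → ℤ) →
    sum f * sum g ≡ ∑[ i < m ] ∑[ j < n ] (f i * g j)
  sum*sum {m} f g = trans (*-distribʳ-sum (sum g) f) (sum-cong-≗ {m} λ i → *-distribˡ-sum (f i) g)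

  sum-scaled₂ : ∀ {m n} c (g : Fin m → Fin n → ℤ) →
    ∑[ i < m ] ∑[ j < n ] (c * g i j) ≡ c * ∑[ i < m ] ∑[ j < n ] g i j
  sum-scaled₂ {m} {n} c g = sym (trans (*-distribˡ-sum c λ i → ∑[ j < n ] g i j)
    (sum-cong-≗ {m} λ i → *-distribˡ-sum c (g i)))

  -- Second moments of weighted sums over dilated translates.

  module _ {q : ℕ} (F : FinField q) where
    open FinField F
    open ≡-Reasoning

    norm² : (Fin q → ℤ) → ℤ
    norm² f = ∑[ x < q ] (f x * f x)

    -- For equal `h` and `h′`, translation by `c ⊗ h` turns each inner sum into `norm² f`. Otherwise
    -- the same translation leaves the shift `c ⊗ d` with `d` nonzero. Multiplication by `d`
    -- permutes the field, so summing over `c` first gives `f x` times `sum f`, which is zero.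
    correlation : ∀ f → sum f ≡ 0ℤ → ∀ h h′ →
      ∑[ c < q ] ∑[ x < q ] (f (x ⊕ c ⊗ h) * f (x ⊕ c ⊗ h′)) ≡ ⟦ h ≟ h′ ⟧ * (+ q * norm² f)
    correlation f ∑f≡0 h h′ with h ≟ h′
    ... | yes refl = begin
      ∑[ c < q ] ∑[ x < q ] (f (x ⊕ c ⊗ h) * f (x ⊕ c ⊗ h))
        ≡⟨ sum-cong-≗ {q} (λ c → trans
             (sum-cong-≗ {q} λ x → cong (λ y → f y * f y) (+-comm x (c ⊗ h)))
             (sum-translate F (λ x → f x * f x) (c ⊗ h))) ⟩
      ∑[ c < q ] norm² f      ≡⟨ sum-const q (norm² f) ⟩
      + q * norm² f           ≡⟨ ℤₚ.*-identityˡ _ ⟨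
      1ℤ * (+ q * norm² f)    ∎
    ... | no h≢h′ = begin
      ∑[ c < q ] ∑[ x < q ] (f (x ⊕ c ⊗ h) * f (x ⊕ c ⊗ h′))
        ≡⟨ sum-cong-≗ {q} (λ c → trans
             (sum-cong-≗ {q} λ x → cong₂ _*_ (cong f (+-comm x (c ⊗ h))) (cong f (shift c x)))
             (sum-translate F (λ x → f x * f (x ⊕ c ⊗ d)) (c ⊗ h))) ⟩
      ∑[ c < q ] ∑[ x < q ] (f x * f (x ⊕ c ⊗ d))  ≡⟨ ∑-comm (λ c x → f x * f (x ⊕ c ⊗ d)) ⟩
      ∑[ x < q ] ∑[ c < q ] (f x * f (x ⊕ c ⊗ d))  ≡⟨ sum-zero {q} vanish ⟩
      0ℤ                                           ≡⟨ ℤₚ.*-zeroˡ (+ q * norm² f) ⟨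
      0ℤ * (+ q * norm² f)                         ∎
      where
      d = h′ ⊕ ⊖ h

      d≢𝟘 : d ≢ 𝟘
      d≢𝟘 = h≢h′ ∘ sym ∘ ⊖≡𝟘⇒≡ F

      shift : ∀ c x → x ⊕ c ⊗ h′ ≡ (c ⊗ h ⊕ x) ⊕ c ⊗ d
      shift c x = begin
        x ⊕ c ⊗ h′               ≡⟨ cong (λ y → x ⊕ c ⊗ y) (⊖-cancel F h h′) ⟨
        x ⊕ c ⊗ (h ⊕ d)          ≡⟨ solve 4 (λ x c h d → x :+ c :* (h :+ d) := (c :* h :+ x) :+ c :* d) refl x c h d ⟩
        (c ⊗ h ⊕ x) ⊕ c ⊗ d      ∎
        where open Solver F

      vanish : ∀ x → ∑[ c < q ] (f x * f (x ⊕ c ⊗ d)) ≡ 0ℤ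
      vanish x = begin
        ∑[ c < q ] (f x * f (x ⊕ c ⊗ d))  ≡⟨ *-distribˡ-sum (f x) (λ c → f (x ⊕ c ⊗ d)) ⟨
        f x * ∑[ c < q ] f (x ⊕ c ⊗ d)    ≡⟨ cong (f x *_) (sum-scale F (λ y → f (x ⊕ y)) d≢𝟘) ⟩
        f x * ∑[ y < q ] f (x ⊕ y)        ≡⟨ cong (f x *_) (trans (sum-translate F f x) ∑f≡0) ⟩
        f x * 0ℤ                          ≡⟨ ℤₚ.*-zeroʳ (f x) ⟩
        0ℤ                                ∎

    module _ (r f : Fin q → ℤ) where

      -- This is A_c f of the opening sketch, with an arbitrary weight `r` in place of the indicator
      -- of H.
      smear : Fin q → Fin q → ℤ
      smear c x = ∑[ h < q ] (r h * f (x ⊕ c ⊗ h))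

      -- Expanding the square gives a sum over pairs `h`, `h′` of correlations, of which only the
      -- diagonal survives.
      ∑norm²-smear : sum f ≡ 0ℤ → ∑[ c < q ] norm² (smear c) ≡ norm² r * (+ q * norm² f)
      ∑norm²-smear ∑f≡0 = begin
        ∑[ c < q ] ∑[ x < q ] (smear c x * smear c x)
          ≡⟨ sum-cong-≗ {q} (λ c → sum-cong-≗ {q} λ x → sum*sum (t c x) (t c x)) ⟩
        ∑[ c < q ] ∑[ x < q ] ∑[ h < q ] ∑[ h′ < q ] (t c x h * t c x h′)
          ≡⟨ sum-rotate (λ c x h → ∑[ h′ < q ] (t c x h * t c x h′)) ⟩
        ∑[ h < q ] ∑[ c < q ] ∑[ x < q ] ∑[ h′ < q ] (t c x h * t c x h′)
          ≡⟨ sum-cong-≗ {q} (λ h → sum-rotate (λ c x h′ → t c x h * t c x h′)) ⟩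
        ∑[ h < q ] ∑[ h′ < q ] ∑[ c < q ] ∑[ x < q ] (t c x h * t c x h′)
          ≡⟨ sum-cong-≗ {q} (λ h → sum-cong-≗ {q} (λ h′ → pair h h′)) ⟩
        ∑[ h < q ] ∑[ h′ < q ] (⟦ h ≟ h′ ⟧ * (r h * r h′ * M))
          ≡⟨ sum-cong-≗ {q} (λ h → sum-δ h λ h′ → r h * r h′ * M) ⟩
        ∑[ h < q ] (r h * r h * M)
          ≡⟨ *-distribʳ-sum M (λ h → r h * r h) ⟨
        norm² r * M ∎
        where
        M = + q * norm² f

        t : Fin q → Fin q → Fin q → ℤ
        t c x h = r h * f (x ⊕ c ⊗ h)

        rearrange : ∀ a b u v → a * u * (b * v) ≡ a * b * (u * v)
        rearrange = solve-∀

        swap : ∀ a b m → a * (b * m) ≡ b * (a * m)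
        swap = solve-∀

        pair : ∀ h h′ → ∑[ c < q ] ∑[ x < q ] (t c x h * t c x h′) ≡ ⟦ h ≟ h′ ⟧ * (r h * r h′ * M)
        pair h h′ = begin
          ∑[ c < q ] ∑[ x < q ] (t c x h * t c x h′)
            ≡⟨ sum-cong-≗ {q} (λ c → sum-cong-≗ {q} λ x → rearrange (r h) (r h′) (f (x ⊕ c ⊗ h)) (f (x ⊕ c ⊗ h′))) ⟩
          ∑[ c < q ] ∑[ x < q ] (r h * r h′ * (f (x ⊕ c ⊗ h) * f (x ⊕ c ⊗ h′)))
            ≡⟨ sum-scaled₂ (r h * r h′) (λ c x → f (x ⊕ c ⊗ h) * f (x ⊕ c ⊗ h′)) ⟩
          r h * r h′ * ∑[ c < q ] ∑[ x < q ] (f (x ⊕ c ⊗ h) * f (x ⊕ c ⊗ h′))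
            ≡⟨ cong (r h * r h′ *_) (correlation f ∑f≡0 h h′) ⟩
          r h * r h′ * (⟦ h ≟ h′ ⟧ * M)
            ≡⟨ swap (r h * r h′) ⟦ h ≟ h′ ⟧ M ⟩
          ⟦ h ≟ h′ ⟧ * (r h * r h′ * M) ∎

      -- At c = 0 every translate is `f` itself, so the smear is `sum r` times `f`.
      norm²-smear-𝟘 : norm² (smear 𝟘) ≡ sum r * sum r * norm² f
      norm²-smear-𝟘 = begin
        norm² (smear 𝟘)
          ≡⟨ sum-cong-≗ {q} (λ x → trans (cong₂ _*_ (constant x) (constant x)) (square (sum r) (f x))) ⟩
        ∑[ x < q ] (sum r * sum r * (f x * f x))  ≡⟨ *-distribˡ-sum (sum r * sum r) (λ x → f x * f x) ⟨
        sum r * sum r * norm² f                   ∎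
        where
        square : ∀ a b → a * b * (a * b) ≡ a * a * (b * b)
        square = solve-∀

        constant : ∀ x → smear 𝟘 x ≡ sum r * f x
        constant x = begin
          ∑[ h < q ] (r h * f (x ⊕ 𝟘 ⊗ h))
            ≡⟨ sum-cong-≗ {q} (λ h → cong (λ y → r h * f y) (trans (cong (x ⊕_) (zeroˡ h)) (+-identityʳ x))) ⟩
          ∑[ h < q ] (r h * f x)  ≡⟨ *-distribʳ-sum (f x) r ⟨
          sum r * f x             ∎

      -- Reindexing the sum over `h` by multiplication by `c` leaves the weights unchanged, so the
      -- two smears agree already pointwise.
      norm²-smear-invariant : ∀ {c} → c ≢ 𝟘 → (∀ h → r (c ⊗ h) ≡ r h) →
        norm² (smear c) ≡ norm² (smear 𝟙)
      norm²-smear-invariant {c} c≢𝟘 r-inv = sum-cong-≗ {q} λ x → cong (λ i → i * i) (same x)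
        where
        same : ∀ x → smear c x ≡ smear 𝟙 x
        same x = begin
          ∑[ h < q ] (r h * f (x ⊕ c ⊗ h))
            ≡⟨ sum-cong-≗ {q} (λ h → cong₂ (λ i y → i * f (x ⊕ y))
                 (trans (sym (r-inv h)) (cong r (*-comm c h)))
                 (trans (*-comm c h) (sym (*-identityˡ (h ⊗ c))))) ⟩
          ∑[ h < q ] (r (h ⊗ c) * f (x ⊕ 𝟙 ⊗ (h ⊗ c)))
            ≡⟨ sum-scale F (λ h → r h * f (x ⊕ 𝟙 ⊗ h)) c≢𝟘 ⟩
          ∑[ h < q ] (r h * f (x ⊕ 𝟙 ⊗ h)) ∎

  -- Sets with no difference in a multiplicative subgroup.

  record IsSubgroup {q : ℕ} (F : FinField q) (H : Fin q → Set) : Set where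
    open FinField F
    field
      nonzero     : ∀ {h} → H h → h ≢ 𝟘
      𝟙∈          : H 𝟙
      ⊗-closed    : ∀ {c h} → H c → H h → H (c ⊗ h)
      -- Stands in for closure under inverses. With `⊗-closed` it makes the indicator of `H`
      -- invariant under multiplication by members of `H`.
      ⊗-cancelled : ∀ {c h} → H c → H (c ⊗ h) → H h

  module _ {q : ℕ} {H : Fin q → Set} (H? : Decidable H) where

    indicator : Fin q → ℤ
    indicator h = ⟦ H? h ⟧

    order : ℤ
    order = sum indicator

  module _ {q : ℕ} (F : FinField q) where
    open FinField F

    module _ {H : Fin q → Set} (H? : Decidable H) (isSubgroup : IsSubgroup F H) where
      open IsSubgroup isSubgroup

      private
        r = indicator H?
        |H| = order H?

      1≤order : 1ℤ ≤ |H|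
      1≤order = subst (_≤ |H|) (⟦⟧-true (H? 𝟙) 𝟙∈) (term≤sum (λ h → ⟦⟧-nonNeg (H? h)) 𝟙)

      -- The values `W c` sum to |H| q N. Keeping only c = 0, worth |H|² N, and the c in H, each
      -- worth `W 𝟙`, drops only nonnegative terms. One factor |H| is then cancelled.
      norm²-smear-bound : ∀ f → sum f ≡ 0ℤ →
        norm² F (smear F r f 𝟙) + norm² F f ≤ + q * norm² F f
      norm²-smear-bound f ∑f≡0 = ℤₚ.*-cancelˡ-≤-pos (W 𝟙 + N) (+ q * N) |H|
        ⦃ positive (ℤₚ.<-≤-trans (ℤ.+<+ (ℕ.s≤s ℕ.z≤n)) 1≤order) ⦄ (begin
        |H| * (W 𝟙 + N)
          ≡⟨ split |H| (W 𝟙) N ⟩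
        1ℤ * (|H| * N) + |H| * W 𝟙
          -- Estimating one factor |H| from below by 1 weakens the bound (q - |H|) N to (q - 1) N.
          ≤⟨ ℤₚ.+-monoˡ-≤ (|H| * W 𝟙) (ℤₚ.*-monoʳ-≤-nonNeg (|H| * N)
               ⦃ nonNegative (*-nonNeg 0≤order N-nonNeg) ⦄ 1≤order) ⟩
        |H| * (|H| * N) + |H| * W 𝟙
          ≡⟨ cong₂ _+_ (trans (sym (ℤₚ.*-assoc |H| |H| N)) (sym (norm²-smear-𝟘 F r f)))
               (*-distribʳ-sum (W 𝟙) r) ⟩
        W 𝟘 + ∑[ c < q ] (r c * W 𝟙)
          ≡⟨ cong₂ _+_ (sum-δ 𝟘 W) (sum-cong-≗ {q} on-H) ⟨
        ∑[ c < q ] (⟦ 𝟘 ≟ c ⟧ * W c) + ∑[ c < q ] (r c * W c)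
          ≡⟨ ∑-distrib-+ (λ c → ⟦ 𝟘 ≟ c ⟧ * W c) (λ c → r c * W c) ⟨
        ∑[ c < q ] (⟦ 𝟘 ≟ c ⟧ * W c + r c * W c)
          ≤⟨ sum-mono {q} disjoint ⟩
        ∑[ c < q ] W c
          ≡⟨ ∑norm²-smear F r f ∑f≡0 ⟩
        norm² F r * (+ q * N)
          ≡⟨ cong (_* (+ q * N)) (sum-cong-≗ {q} λ h → ⟦⟧-idem (H? h)) ⟩
        |H| * (+ q * N) ∎)
        where
        open ℤₚ.≤-Reasoning
        N = norm² F f

        W : Fin q → ℤ
        W c = norm² F (smear F r f c)

        W-nonNeg : ∀ c → 0ℤ ≤ W c
        W-nonNeg c = sum-nonNeg {q} λ x → square-nonNeg (smear F r f c x)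

        N-nonNeg : 0ℤ ≤ N
        N-nonNeg = sum-nonNeg {q} λ x → square-nonNeg (f x)

        0≤order : 0ℤ ≤ |H|
        0≤order = ℤₚ.≤-trans (+≤+ ℕ.z≤n) 1≤order

        split : ∀ a w m → a * (w + m) ≡ 1ℤ * (a * m) + a * w
        split = solve-∀

        on-H : ∀ c → r c * W c ≡ r c * W 𝟙
        on-H c with H? c
        ... | yes c∈H = cong (1ℤ *_) (norm²-smear-invariant F r f (nonzero c∈H)
          λ h → ⟦⟧-cong (H? (c ⊗ h)) (H? h) (⊗-cancelled c∈H) (⊗-closed c∈H))
        ... | no  _   = refl

        -- Zero is not in `H`, so no `W c` is counted twice.
        disjoint : ∀ c → ⟦ 𝟘 ≟ c ⟧ * W c + r c * W c ≤ W c
        disjoint c with 𝟘 ≟ c | H? c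
        ... | yes 𝟘≡c | yes c∈H = contradiction (sym 𝟘≡c) (nonzero c∈H)
        ... | yes _   | no _    = ℤₚ.≤-reflexive (trans (ℤₚ.+-identityʳ _) (ℤₚ.*-identityˡ (W c)))
        ... | no _    | yes _   = ℤₚ.≤-reflexive (trans (ℤₚ.+-identityˡ _) (ℤₚ.*-identityˡ (W c)))
        ... | no _    | no _    = W-nonNeg c

      -- The squared norm of `smear F r f 𝟙` is at least e s², from the points of `E` alone, and at
      -- most (q - 1) N, where N ≤ e q². The positive factor `e` cancels.
      independent-bound : ∀ (E : Subset q) .{{_ : NonZero ∣ E ∣}} →
        (∀ {x h} → x ∈ₛ E → H h → x ⊕ h ∉ E) →
        + ∣ E ∣ * |H| * (+ ∣ E ∣ * |H|) ≤ (+ q - 1ℤ) * (+ q * + q)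
      independent-bound E independent =
        ℤₚ.*-cancelˡ-≤-pos (s * s) ((Q - 1ℤ) * (Q * Q)) e
          ⦃ positive (ℤ.+<+ (ℕ.>-nonZero⁻¹ ∣ E ∣)) ⦄ (begin
          e * (s * s)
            ≡⟨ add-sub (e * (s * s)) N ⟩
          e * (s * s) + N - N
            ≤⟨ ℤₚ.+-monoˡ-≤ (- N) (ℤₚ.≤-trans (ℤₚ.+-monoˡ-≤ N W-bound) (norm²-smear-bound f ∑f≡0)) ⟩
          Q * N - N
            ≡⟨ factor Q N ⟩
          (Q - 1ℤ) * N
            ≤⟨ ℤₚ.*-monoˡ-≤-nonNeg (Q - 1ℤ) ⦃ nonNegative 0≤Q-1 ⦄ N-bound ⟩
          (Q - 1ℤ) * (e * (Q * Q))
            ≡⟨ swap (Q - 1ℤ) e (Q * Q) ⟩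
          e * ((Q - 1ℤ) * (Q * Q)) ∎)
        where
        open ℤₚ.≤-Reasoning
        e = + ∣ E ∣
        Q = + q
        s = e * |H|

        b : Fin q → ℤ
        b x = ⟦ x ∈? E ⟧

        -- q times the deviation of the indicator of E from its mean.
        f : Fin q → ℤ
        f x = b x * Q + - e

        N = norm² F f

        ∑f≡0 : sum f ≡ 0ℤ
        ∑f≡0 = begin-equality
          sum f                                   ≡⟨ ∑-distrib-+ (λ x → b x * Q) (λ _ → - e) ⟩
          ∑[ x < q ] (b x * Q) + ∑[ x < q ] (- e) ≡⟨ cong₂ _+_ (*-distribʳ-sum Q b) (sym (sum-const q (- e))) ⟨
          sum b * Q + Q * - e                     ≡⟨ cong (λ i → i * Q + Q * - e) (sum-∈ E) ⟩
          e * Q + Q * - e                         ≡⟨ cancel e Q ⟩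
          0ℤ                                      ∎
          where
          cancel : ∀ e Q → e * Q + Q * - e ≡ 0ℤ
          cancel = solve-∀

        0≤Q-1 : 0ℤ ≤ Q - 1ℤ
        0≤Q-1 = ℤₚ.i≤j⇒0≤j-i (positive-size 𝟘)
          where
          positive-size : ∀ {m} → Fin m → 1ℤ ≤ + m
          positive-size {suc m} _ = +≤+ (ℕ.s≤s ℕ.z≤n)

        -- As `b` takes only the values 0 and 1, expanding the square gives exactly e q² - q e², and
        -- the subtracted term is dropped.
        N-bound : N ≤ e * (Q * Q)
        N-bound = begin
          N
            ≡⟨ sum-cong-≗ {q} (λ x → trans (expand (b x) Q e)
                 (cong (λ i → i * (Q * Q) + b x * (- (Q * e + Q * e)) + e * e) (⟦⟧-idem (x ∈? E)))) ⟩
          ∑[ x < q ] (b x * (Q * Q) + b x * (- (Q * e + Q * e)) + e * e)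
            ≡⟨ sum-cong-≗ {q} (λ x → cong (_+ e * e) (sym (ℤₚ.*-distribˡ-+ (b x) _ _))) ⟩
          ∑[ x < q ] (b x * (Q * Q + - (Q * e + Q * e)) + e * e)
            ≡⟨ ∑-distrib-+ (λ x → b x * (Q * Q + - (Q * e + Q * e))) (λ _ → e * e) ⟩
          ∑[ x < q ] (b x * (Q * Q + - (Q * e + Q * e))) + ∑[ x < q ] (e * e)
            ≡⟨ cong₂ _+_ (*-distribʳ-sum (Q * Q + - (Q * e + Q * e)) b) (sym (sum-const q (e * e))) ⟨
          sum b * (Q * Q + - (Q * e + Q * e)) + Q * (e * e)
            ≡⟨ cong (λ i → i * (Q * Q + - (Q * e + Q * e)) + Q * (e * e)) (sum-∈ E) ⟩
          e * (Q * Q + - (Q * e + Q * e)) + Q * (e * e)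
            ≡⟨ collect e Q ⟩
          e * (Q * Q) - Q * (e * e)
            ≤⟨ ℤₚ.i-j≤i (e * (Q * Q)) (Q * (e * e))
                 ⦃ nonNegative (*-nonNeg {Q} {e * e} (+≤+ ℕ.z≤n) (square-nonNeg e)) ⦄ ⟩
          e * (Q * Q) ∎
          where
          expand : ∀ b Q e → (b * Q + - e) * (b * Q + - e) ≡ b * b * (Q * Q) + b * (- (Q * e + Q * e)) + e * e
          expand = solve-∀
          collect : ∀ e Q → e * (Q * Q + - (Q * e + Q * e)) + Q * (e * e) ≡ e * (Q * Q) - Q * (e * e)
          collect = solve-∀

        -- Every translate of `x` by a member of `H` misses `E`, where `f` has the value -e.
        smear-on-E : ∀ {x} → x ∈ₛ E → smear F r f 𝟙 x ≡ - s
        smear-on-E {x} x∈E = begin-equality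
          ∑[ h < q ] (r h * f (x ⊕ 𝟙 ⊗ h))
            ≡⟨ sum-cong-≗ {q} (λ h → cong (λ y → r h * f (x ⊕ y)) (*-identityˡ h)) ⟩
          ∑[ h < q ] (r h * f (x ⊕ h))
            ≡⟨ sum-cong-≗ {q} avoid ⟩
          ∑[ h < q ] (r h * - e)  ≡⟨ *-distribʳ-sum (- e) r ⟨
          |H| * - e               ≡⟨ negate |H| e ⟩
          - (e * |H|)             ∎
          where
          negate : ∀ i j → i * - j ≡ - (j * i)
          negate = solve-∀
          avoid : ∀ h → r h * f (x ⊕ h) ≡ r h * - e
          avoid h with H? h
          ... | no  _   = refl
          ... | yes h∈H = cong (1ℤ *_) (trans
            (cong (λ i → i * Q + - e) (⟦⟧-false (x ⊕ h ∈? E) (independent x∈E h∈H)))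
            (trans (cong (_+ - e) (ℤₚ.*-zeroˡ Q)) (ℤₚ.+-identityˡ (- e))))

        W-bound : e * (s * s) ≤ norm² F (smear F r f 𝟙)
        W-bound = begin
          e * (s * s)                   ≡⟨ cong (_* (s * s)) (sum-∈ E) ⟨
          sum b * (s * s)               ≡⟨ *-distribʳ-sum (s * s) b ⟩
          ∑[ x < q ] (b x * (s * s))    ≤⟨ sum-mono {q} pointwise ⟩
          norm² F (smear F r f 𝟙)       ∎
          where
          square-neg : ∀ i → 1ℤ * (i * i) ≡ - i * - i
          square-neg = solve-∀
          pointwise : ∀ x → b x * (s * s) ≤ smear F r f 𝟙 x * smear F r f 𝟙 x
          pointwise x with x ∈? E
          ... | yes x∈E = ℤₚ.≤-reflexive (trans (square-neg s) (sym (cong (λ i → i * i) (smear-on-E x∈E))))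
          ... | no  _   = square-nonNeg (smear F r f 𝟙 x)

        add-sub : ∀ i j → i ≡ i + j - j
        add-sub = solve-∀

        factor : ∀ i j → i * j - j ≡ (i - 1ℤ) * j
        factor = solve-∀

        swap : ∀ i j k → i * (j * k) ≡ j * (i * k)
        swap = solve-∀

    -- The group of nonzero k-th powers and its order.

    NonzeroPower : ℕ → Fin q → Set
    NonzeroPower k h = ∃[ x ] (x ≢ 𝟘 × x ^ k ≡ h)

    nonzeroPower? : ∀ k → Decidable (NonzeroPower k)
    nonzeroPower? k h = any? (λ x → ¬? (x ≟ 𝟘) ×-dec x ^ k ≟ h)

    1^ : ∀ k → 𝟙 ^ k ≡ 𝟙
    1^ zero    = refl
    1^ (suc k) = trans (*-identityˡ _) (1^ k)

    nonzeroPower-isSubgroup : ∀ k → IsSubgroup F (NonzeroPower k)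
    nonzeroPower-isSubgroup k = record
      { nonzero     = λ { (_ , x≢𝟘 , refl) → ^-nonzero F k x≢𝟘 }
      ; 𝟙∈          = 𝟙 , 𝟙≢𝟘 , 1^ k
      ; ⊗-closed    = λ { (x , x≢𝟘 , refl) (y , y≢𝟘 , refl) →
          x ⊗ y , ⊗-nonzero F x≢𝟘 y≢𝟘 , ^-distrib-* x y k }
      ; ⊗-cancelled = cancelled
      }
      where
      open ≡-Reasoning
      -- If c = x^k and ch = y^k, then h is the k-th power of y / x.
      cancelled : ∀ {c h} → NonzeroPower k c → NonzeroPower k (c ⊗ h) → NonzeroPower k h
      cancelled {c} {h} (x , x≢𝟘 , xᵏ≡c) (y , y≢𝟘 , yᵏ≡ch) =
        z ⊗ y , ⊗-nonzero F z≢𝟘 y≢𝟘 , (begin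
          (z ⊗ y) ^ k            ≡⟨ ^-distrib-* z y k ⟩
          z ^ k ⊗ y ^ k          ≡⟨ cong (z ^ k ⊗_) (trans yᵏ≡ch (cong (_⊗ h) (sym xᵏ≡c))) ⟩
          z ^ k ⊗ (x ^ k ⊗ h)    ≡⟨ *-assoc (z ^ k) (x ^ k) h ⟨
          z ^ k ⊗ x ^ k ⊗ h      ≡⟨ cong (_⊗ h) (^-distrib-* z x k) ⟨
          (z ⊗ x) ^ k ⊗ h        ≡⟨ cong (λ u → u ^ k ⊗ h) (trans (*-comm z x) xz≡𝟙) ⟩
          𝟙 ^ k ⊗ h              ≡⟨ cong (_⊗ h) (1^ k) ⟩
          𝟙 ⊗ h                  ≡⟨ *-identityˡ h ⟩
          h                      ∎)
        where
        z = proj₁ (inverse x≢𝟘)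
        xz≡𝟙 = proj₂ (inverse x≢𝟘)
        z≢𝟘 : z ≢ 𝟘
        z≢𝟘 z≡𝟘 = 𝟙≢𝟘 (trans (sym xz≡𝟙) (trans (cong (x ⊗_) z≡𝟘) (zeroʳ x)))

    -- Every nonzero element lies in the fibre of the power map over a member of H, and each fibre
    -- has at most k elements. The summand 1 accounts for zero.
    q≤1+k*order : ∀ k .{{_ : NonZero k}} →
      + q ≤ 1ℤ + + k * order (nonzeroPower? k)
    q≤1+k*order k = begin
      + q
        ≡⟨ ℤₚ.*-identityʳ (+ q) ⟨
      + q * 1ℤ
        ≡⟨ sum-const q 1ℤ ⟨
      ∑[ x < q ] 1ℤ
        ≤⟨ sum-mono {q} zero-or-power ⟩
      ∑[ x < q ] (⟦ 𝟘 ≟ x ⟧ * 1ℤ + r (x ^ k))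
        ≡⟨ ∑-distrib-+ (λ x → ⟦ 𝟘 ≟ x ⟧ * 1ℤ) (λ x → r (x ^ k)) ⟩
      ∑[ x < q ] (⟦ 𝟘 ≟ x ⟧ * 1ℤ) + ∑[ x < q ] r (x ^ k)
        -- The second sum is sorted by the value `h` of `x ^ k`, so that exchanging the sums counts
        -- fibres.
        ≡⟨ cong₂ _+_ (sum-δ 𝟘 (λ _ → 1ℤ)) (sum-cong-≗ {q} λ x → sym (sum-δ (x ^ k) r)) ⟩
      1ℤ + ∑[ x < q ] ∑[ h < q ] (⟦ x ^ k ≟ h ⟧ * r h)
        ≡⟨ cong (_+_ 1ℤ) (∑-comm λ x h → ⟦ x ^ k ≟ h ⟧ * r h) ⟩
      1ℤ + ∑[ h < q ] ∑[ x < q ] (⟦ x ^ k ≟ h ⟧ * r h)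
        ≡⟨ cong (_+_ 1ℤ) (sum-cong-≗ {q} λ h → *-distribʳ-sum (r h) λ x → ⟦ x ^ k ≟ h ⟧) ⟨
      1ℤ + ∑[ h < q ] (∑[ x < q ] ⟦ x ^ k ≟ h ⟧ * r h)
        ≤⟨ ℤₚ.+-monoʳ-≤ 1ℤ (sum-mono {q} λ h →
             ℤₚ.*-monoʳ-≤-nonNeg (r h) ⦃ nonNegative (⟦⟧-nonNeg (nonzeroPower? k h)) ⦄ (∑[^≡]≤ F k h)) ⟩
      1ℤ + ∑[ h < q ] (+ k * r h)
        ≡⟨ cong (_+_ 1ℤ) (*-distribˡ-sum (+ k) r) ⟨
      1ℤ + + k * sum r ∎
      where
      open ℤₚ.≤-Reasoning

      r : Fin q → ℤ
      r = indicator (nonzeroPower? k)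

      zero-or-power : ∀ x → 1ℤ ≤ ⟦ 𝟘 ≟ x ⟧ * 1ℤ + r (x ^ k)
      zero-or-power x with 𝟘 ≟ x
      ... | yes _   = ℤₚ.i≤i+j 1ℤ _ ⦃ nonNegative (⟦⟧-nonNeg (nonzeroPower? k (x ^ k))) ⦄
      ... | no  𝟘≢x = ℤₚ.≤-reflexive (sym (trans (ℤₚ.+-identityˡ _)
        (⟦⟧-true (nonzeroPower? k (x ^ k)) (x , 𝟘≢x ∘ sym , refl))))

    -- Joins the bound on |E||H| with q - 1 ≤ k|H|, both moved from ℤ to ℕ. An empty `E` is treated
    -- apart because `independent-bound` divides by the size of `E`.
    power-independent-bound : ∀ k .{{_ : NonZero k}} (E : Subset q) →
      (∀ {x h} → x ∈ₛ E → NonzeroPower k h → x ⊕ h ∉ E) →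
      ∣ E ∣ ℕ.^ 2 ℕ.* (q ℕ.∸ 1) ℕ.≤ (q ℕ.* k) ℕ.^ 2
    power-independent-bound k E independent with ∣ E ∣ ℕₚ.≟ 0
    ... | yes e≡0 = subst (λ e → e ℕ.^ 2 ℕ.* (q ℕ.∸ 1) ℕ.≤ (q ℕ.* k) ℕ.^ 2) (sym e≡0) ℕ.z≤n
    ... | no  e≢0 = combine e k o p q (ℤₚ.drop‿+≤+ eo-bound) (ℕₚ.m≤n+o⇒m∸n≤o q 1 (ℤₚ.drop‿+≤+ q-bound))
      where
      open ℤₚ.≤-Reasoning
      e = ∣ E ∣
      p = q ℕ.∸ 1
      c = order (nonzeroPower? k)
      o = ℤ.∣ c ∣

      +o≡c : + o ≡ c
      +o≡c = ℤₚ.0≤i⇒+∣i∣≡i (ℤₚ.≤-trans (+≤+ ℕ.z≤n) (1≤order (nonzeroPower? k) (nonzeroPower-isSubgroup k)))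

      q-bound : + q ≤ + (1 ℕ.+ k ℕ.* o)
      q-bound = begin
        + q                ≤⟨ q≤1+k*order k ⟩
        1ℤ + + k * c       ≡⟨ cong (λ i → 1ℤ + + k * i) +o≡c ⟨
        1ℤ + + k * + o     ≡⟨ cong (_+_ 1ℤ) (ℤₚ.pos-* k o) ⟨
        + (1 ℕ.+ k ℕ.* o)  ∎

      eo-bound : + (e ℕ.* o ℕ.* (e ℕ.* o)) ≤ + (p ℕ.* (q ℕ.* q))
      eo-bound = begin
        + (e ℕ.* o ℕ.* (e ℕ.* o))
          ≡⟨ ℤₚ.pos-* (e ℕ.* o) (e ℕ.* o) ⟩
        + (e ℕ.* o) * + (e ℕ.* o)
          ≡⟨ cong (λ i → i * i) (trans (ℤₚ.pos-* e o) (cong (+ e *_) +o≡c)) ⟩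
        + e * c * (+ e * c)
          ≤⟨ independent-bound (nonzeroPower? k) (nonzeroPower-isSubgroup k) E ⦃ ℕ.≢-nonZero e≢0 ⦄ independent ⟩
        (+ q - 1ℤ) * (+ q * + q)
          -- Truncated subtraction agrees with integer subtraction here: `𝟘` inhabits `Fin q`, so q
          -- ≥ 1.
          ≡⟨ cong₂ _*_ (trans (ℤₚ.m-n≡m⊖n q 1) (ℤₚ.⊖-≥ (ℕ.>-nonZero⁻¹ q ⦃ nonZeroIndex 𝟘 ⦄)))
               (sym (ℤₚ.pos-* q q)) ⟩
        + p * + (q ℕ.* q)
          ≡⟨ ℤₚ.pos-* p (q ℕ.* q) ⟨
        + (p ℕ.* (q ℕ.* q)) ∎

      -- Multiplying by one more `p` lets both factors `p` be replaced by `k * o`, after which the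
      -- bound on `e * o` applies and returns a factor `p` to cancel. Cancellation needs `p`
      -- nonzero, hence the case split.
      combine : ∀ e k o p q → e ℕ.* o ℕ.* (e ℕ.* o) ℕ.≤ p ℕ.* (q ℕ.* q) → p ℕ.≤ k ℕ.* o →
        e ℕ.^ 2 ℕ.* p ℕ.≤ (q ℕ.* k) ℕ.^ 2
      combine e k o zero q _ _ = subst (ℕ._≤ (q ℕ.* k) ℕ.^ 2) (sym (ℕₚ.*-zeroʳ (e ℕ.^ 2))) ℕ.z≤n
      combine e k o p@(suc _) q eo-bound p-bound = ℕₚ.*-cancelˡ-≤ p (ℕB.begin
        p ℕ.* (e ℕ.^ 2 ℕ.* p)                       ℕB.≡⟨ regroup₁ p e ⟩
        e ℕ.* e ℕ.* (p ℕ.* p)                       ℕB.≤⟨ ℕₚ.*-monoʳ-≤ (e ℕ.* e) (ℕₚ.*-mono-≤ p-bound p-bound) ⟩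
        e ℕ.* e ℕ.* (k ℕ.* o ℕ.* (k ℕ.* o))         ℕB.≡⟨ regroup₂ e k o ⟩
        k ℕ.* k ℕ.* (e ℕ.* o ℕ.* (e ℕ.* o))         ℕB.≤⟨ ℕₚ.*-monoʳ-≤ (k ℕ.* k) eo-bound ⟩
        k ℕ.* k ℕ.* (p ℕ.* (q ℕ.* q))               ℕB.≡⟨ regroup₃ k p q ⟩
        p ℕ.* (q ℕ.* k) ℕ.^ 2                       ℕB.∎)
        where
        module ℕB = ℕₚ.≤-Reasoning
        -- Squares are written as `^ 2` unfolds, so these identities fit the chain by computation.
        regroup₁ : ∀ p e → p ℕ.* (e ℕ.* (e ℕ.* 1) ℕ.* p) ≡ e ℕ.* e ℕ.* (p ℕ.* p)
        regroup₁ = ℕSolver.solve-∀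
        regroup₂ : ∀ e k o → e ℕ.* e ℕ.* (k ℕ.* o ℕ.* (k ℕ.* o)) ≡ k ℕ.* k ℕ.* (e ℕ.* o ℕ.* (e ℕ.* o))
        regroup₂ = ℕSolver.solve-∀
        regroup₃ : ∀ k p q → k ℕ.* k ℕ.* (p ℕ.* (q ℕ.* q)) ≡ p ℕ.* (q ℕ.* k ℕ.* (q ℕ.* k ℕ.* 1))
        regroup₃ = ℕSolver.solve-∀

-- Transfer to an arbitrary finite field along its enumeration.

open FieldsOnFin
open import Data.Nat.Base using (_+_; _*_; _∸_; _^_; _≤_; s≤s)
open import Data.Rational.Base using (_<_)

module _ {c ℓ₁ ℓ₂} (F : FiniteField c ℓ₁ ℓ₂) where
  open FiniteField F using (_≈_; _#_; 0#; 1#; q; enumeration; tight;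
    #⇒invertible; invertible⇒#; #-irrefl; HasPowerDifference)
    renaming (_^_ to _^ꟳ_)
  open CommutativeRing (FiniteField.commutativeRing F)
    using (refl; sym; trans; +-congˡ; *-cong; *-congˡ; zeroˡ; zeroʳ;
      +-identityʳ; ring; rawRing; isCommutativeRing)
    renaming (_+_ to _+ꟳ_; _*_ to _*ꟳ_; -_ to -ꟳ_; _-_ to _-ꟳ_)
  open Inverse enumeration using (to; from; from-cong; strictlyInverseˡ; strictlyInverseʳ)

  to-injective : ∀ {i j} → to i ≈ to j → i ≡ j
  to-injective {i} {j} eq =
    ≡.trans (≡.sym (strictlyInverseʳ i)) (≡.trans (from-cong eq) (strictlyInverseʳ j))

  indexRawRing : RawRing 0ℓ 0ℓ
  indexRawRing = record
    { Carrier = Fin q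
    ; _≈_     = _≡_
    ; _+_     = λ i j → from (to i +ꟳ to j)
    ; _*_     = λ i j → from (to i *ꟳ to j)
    ; -_      = λ i → from (-ꟳ to i)
    ; 0#      = from 0#
    ; 1#      = from 1#
    }

  -- Injectivity of `to` pulls the ring laws of the field back to the indices, with propositional
  -- equality.
  to-isRingMonomorphism : IsRingMonomorphism indexRawRing rawRing to
  to-isRingMonomorphism = record
    { isRingHomomorphism = record
      { isSemiringHomomorphism = record
        { isNearSemiringHomomorphism = record
          { +-isMonoidHomomorphism = record
            { isMagmaHomomorphism = record
              { isRelHomomorphism = record { cong = λ { ≡.refl → refl } }
              ; homo              = λ _ _ → strictlyInverseˡ _
              }
            ; ε-homo = strictlyInverseˡ 0#
            }
          ; *-homo = λ _ _ → strictlyInverseˡ _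
          }
        ; 1#-homo = strictlyInverseˡ 1#
        }
      ; -‿homo = λ _ → strictlyInverseˡ _
      }
    ; injective = to-injective
    }

  open RawRing indexRawRing using ()
    renaming (_+_ to _⊕_; _*_ to _⊗_; -_ to ⊖_; 0# to 𝟘; 1# to 𝟙)

  -- If 1 = 0, then 0 is an inverse of 0 - 0, which makes 0 apart from itself.
  1≉0 : ¬ 1# ≈ 0#
  1≉0 1≈0 = #-irrefl refl (invertible⇒# {0#} {0#}
    (0# , trans (zeroˡ _) (sym 1≈0) , trans (zeroʳ _) (sym 1≈0)))

  -- Inverses come from apartness, while only inequality is given. A finite search decides
  -- invertibility; if it fails, the element is not apart from 0, and tightness makes it equal to 0.
  index-inverse : ∀ {i} → i ≢ 𝟘 → ∃[ j ] i ⊗ j ≡ 𝟙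
  index-inverse {i} i≢𝟘 with any? (λ j → i ⊗ j ≟ 𝟙)
  ... | yes invertible = invertible
  ... | no  ¬invertible = contradiction
    (≡.trans (≡.sym (strictlyInverseʳ i)) (from-cong (proj₁ (tight (to i) 0#) ¬apart))) i≢𝟘
    where
    -- Apartness from 0 yields an inverse of the difference `to i -ꟳ 0#`, which has to be
    -- simplified.
    i-0≈i : to i -ꟳ 0# ≈ to i
    i-0≈i = trans (+-congˡ (RingProperties.-0#≈0# ring)) (+-identityʳ (to i))

    ¬apart : ¬ to i # 0#
    ¬apart i#0 = let y , _ , iy≈1 = #⇒invertible i#0 in ¬invertible
      (from y , from-cong (trans (*-cong (sym i-0≈i) (strictlyInverseˡ y)) iy≈1))

  indexField : FinField q
  indexField = record
    { _⊕_               = _⊕_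
    ; _⊗_               = _⊗_
    ; ⊖_                = ⊖_
    ; 𝟘                 = 𝟘
    ; 𝟙                 = 𝟙
    ; isCommutativeRing = RingMonomorphism.isCommutativeRing to-isRingMonomorphism isCommutativeRing
    ; 𝟙≢𝟘               = λ 𝟙≡𝟘 → 1≉0
        (trans (sym (strictlyInverseˡ 1#)) (trans (Inverse.to-cong enumeration 𝟙≡𝟘) (strictlyInverseˡ 0#)))
    ; inverse           = index-inverse
    }

  open FinField indexField using () renaming (_^_ to _^ᵢ_)

  to-^ : ∀ i k → to (i ^ᵢ k) ≈ to i ^ꟳ k
  to-^ i zero    = strictlyInverseˡ 1#
  to-^ i (suc k) = trans (strictlyInverseˡ _) (*-congˡ (to-^ i k))

  to-⊖ : ∀ i j → to (i ⊕ ⊖ j) ≈ to i -ꟳ to j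
  to-⊖ i j = trans (strictlyInverseˡ _) (+-congˡ (strictlyInverseˡ _))

  -- The witnesses are found by exhaustive search over indices. A failed search makes `E`
  -- independent, and the resulting bound contradicts its size.
  large⇒powerDifference : ∀ k .{{_ : NonZero k}} (E : Subset q) →
    ∣ E ∣ > q * k /√ (q ∸ 1) → HasPowerDifference k E
  large⇒powerDifference k E large with any? (λ i → any? (λ j →
    (i ∈? E) ×-dec (j ∈? E) ×-dec ¬? (i ≟ j) ×-dec any? (λ a → a ^ᵢ k ≟ i ⊕ ⊖ j)))
  ... | yes (i , j , i∈E , j∈E , i≢j , a , aᵏ≡i-j) =
    to i , to j , subst (_∈ₛ E) (≡.sym (strictlyInverseʳ i)) i∈E ,
    subst (_∈ₛ E) (≡.sym (strictlyInverseʳ j)) j∈E ,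
    i≢j ∘ to-injective , to a ,
    trans (sym (to-⊖ i j)) (trans (Inverse.to-cong enumeration (≡.sym aᵏ≡i-j)) (to-^ a k))
  ... | no  none = contradiction large (ℕₚ.≤⇒≯ (power-independent-bound indexField k E independent))
    where
    independent : ∀ {x h} → x ∈ₛ E → NonzeroPower indexField k h → x ⊕ h ∉ E
    independent {x} {h} x∈E (a , a≢𝟘 , aᵏ≡h) x+h∈E = none
      -- The two elements differ by `h`, a power of a nonzero element and hence nonzero, so they are
      -- distinct.
      ( x ⊕ h , x , x+h∈E , x∈E
      , (λ x+h≡x → ^-nonzero indexField k a≢𝟘 (≡.trans aᵏ≡h (≡.trans (≡.sym (⊕⊖-cancel indexField x h))
          (RingProperties.x≈y⇒x∙y⁻¹≈ε (FinField.ring indexField) x+h≡x))))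
      , a , ≡.trans aᵏ≡h (≡.sym (⊕⊖-cancel indexField x h)))

-- The asymptotic form: a threshold for q in terms of k and C.

fromℕ<⇒cross-< : ∀ k (C : ℚ) → fromℕ k < C → + k ℤ.* ℚ.↧ C ℤ.< ℚ.↥ C ℤ.* + 1
fromℕ<⇒cross-< k C@record{} k<C = ℚᵘₚ.drop-*<*
  (ℚᵘₚ.<-respˡ-≃ (ℚₚ.toℚᵘ-fromℚᵘ (mkℚᵘ (+ k) 0)) (ℚₚ.toℚᵘ-mono-< k<C))

-- Products in ℚ are reduced to lowest terms. Passing to unnormalised fractions keeps numerators and
-- denominators as plain products, and the order there is cross-multiplication.
≥√⇒cross-≤ : ∀ (C : ℚ) e q → e ≥ C √ q →
  ℚ.↥ C ℤ.* ℚ.↥ C ℤ.* + q ℤ.* + 1 ℤ.≤ + (e ^ 2) ℤ.* (ℚ.↧ C ℤ.* ℚ.↧ C ℤ.* + 1)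
≥√⇒cross-≤ C@record{} e q hyp = ℚᵘₚ.drop-*≤* (ℚᵘₚ.≤-respˡ-≃
  (ℚᵘₚ.≃-trans (ℚₚ.toℚᵘ-homo-* (C ℚ.* C) (fromℕ q))
    (ℚᵘₚ.*-cong (ℚₚ.toℚᵘ-homo-* C C) (ℚₚ.toℚᵘ-fromℚᵘ (mkℚᵘ (+ q) 0))))
  (ℚᵘₚ.≤-respʳ-≃ (ℚₚ.toℚᵘ-fromℚᵘ (mkℚᵘ (+ (e ^ 2)) 0)) (ℚₚ.toℚᵘ-mono-≤ hyp)))

-- Both sides are compared after multiplication by b². With m = kb and q = p + 1, splitting one
-- factor q of q² m² isolates a term m², which `mm<p` raises to p.
√-threshold-ℕ : ∀ a b k e p → k * b ℕ.< a → a * a * suc p ≤ e * e * (b * b) → k * b * (k * b) ℕ.< p →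
  (suc p * k) ^ 2 ℕ.< e ^ 2 * p
√-threshold-ℕ a b k e p kb<a aaq≤eebb mm<p = ℕₚ.*-cancelʳ-< (b * b) _ _ (begin-strict
  (suc p * k) ^ 2 * (b * b)    ≡⟨ regroup₁ p k b ⟩
  suc p * (m * m + m * m * p)  <⟨ ℕₚ.*-monoʳ-< (suc p) (ℕₚ.+-monoˡ-< (m * m * p) mm<p) ⟩
  suc p * (p + m * m * p)      ≡⟨ regroup₂ p m ⟩
  -- The strict inequality m² < a² is used in the form m² + 1 ≤ a².
  suc (m * m) * suc p * p      ≤⟨ ℕₚ.*-monoˡ-≤ p (ℕₚ.*-monoˡ-≤ (suc p) (ℕₚ.*-mono-< kb<a kb<a)) ⟩
  a * a * suc p * p            ≤⟨ ℕₚ.*-monoˡ-≤ p aaq≤eebb ⟩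
  e * e * (b * b) * p          ≡⟨ regroup₃ e b p ⟩
  e ^ 2 * p * (b * b)          ∎)
  where
  open ℕₚ.≤-Reasoning
  m = k * b
  regroup₁ : ∀ p k b → suc p * k * (suc p * k * 1) * (b * b) ≡
    suc p * (k * b * (k * b) + k * b * (k * b) * p)
  regroup₁ = ℕSolver.solve-∀
  regroup₂ : ∀ p m → suc p * (p + m * m * p) ≡ suc (m * m) * suc p * p
  regroup₂ = ℕSolver.solve-∀
  regroup₃ : ∀ e b p → e * e * (b * b) * p ≡ e * (e * 1) * p * (b * b)
  regroup₃ = ℕSolver.solve-∀

-- Writing C = a/b, the hypothesis C > k gives a² ≥ (kb)² + 1, and then
-- a²(q − 1) > q(kb)² as soon as q − 1 > (kb)².
√-threshold : ∀ k (C : ℚ) → fromℕ k < C →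
  ∃[ q₀ ] (∀ e q → q₀ ≤ q → e ≥ C √ q → e > q * k /√ (q ∸ 1))
√-threshold k C@(mkℚ -[1+ a ] b-1 _) k<C =
  contradiction (subst (ℤ._< -[1+ a ] ℤ.* + 1) (≡.sym (ℤₚ.pos-* k (suc b-1))) (fromℕ<⇒cross-< k C k<C)) λ ()
-- For q = p + 1 the summand 2 yields the strict inequality (kb)² < p.
√-threshold k C@(mkℚ (+ a) b-1 _) k<C = 2 + k * b * (k * b) , λ
  { e (suc p) (s≤s mm<p) hyp → √-threshold-ℕ a b k e p kb<a (aaq≤eebb e (suc p) hyp) mm<p }
  where
  b = suc b-1
  kb<a : k * b ℕ.< a
  kb<a = ℤₚ.drop‿+<+ (subst₂ ℤ._<_ (≡.sym (ℤₚ.pos-* k b)) (ℤₚ.*-identityʳ (+ a)) (fromℕ<⇒cross-< k C k<C))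
  aaq≤eebb : ∀ e q → e ≥ C √ q → a * a * q ≤ e * e * (b * b)
  aaq≤eebb e q hyp = ℤₚ.drop‿+≤+ (subst₂ ℤ._≤_ lhs rhs (≥√⇒cross-≤ C e q hyp))
    where
    open ≡-Reasoning
    lhs : + a ℤ.* + a ℤ.* + q ℤ.* + 1 ≡ + (a * a * q)
    lhs = begin
      + a ℤ.* + a ℤ.* + q ℤ.* + 1  ≡⟨ ℤₚ.*-identityʳ _ ⟩
      + a ℤ.* + a ℤ.* + q          ≡⟨ cong (ℤ._* + q) (ℤₚ.pos-* a a) ⟨
      + (a * a) ℤ.* + q            ≡⟨ ℤₚ.pos-* (a * a) q ⟨
      + (a * a * q)                ∎
    rhs : + (e ^ 2) ℤ.* (+ b ℤ.* + b ℤ.* + 1) ≡ + (e * e * (b * b))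
    rhs = begin
      + (e ^ 2) ℤ.* (+ b ℤ.* + b ℤ.* + 1)
        ≡⟨ cong₂ ℤ._*_ (cong (λ i → + (e * i)) (ℕₚ.*-identityʳ e)) (ℤₚ.*-identityʳ _) ⟩
      + (e * e) ℤ.* (+ b ℤ.* + b)          ≡⟨ cong (+ (e * e) ℤ.*_) (ℤₚ.pos-* b b) ⟨
      + (e * e) ℤ.* + (b * b)              ≡⟨ ℤₚ.pos-* (e * e) (b * b) ⟨
      + (e * e * (b * b))                  ∎

theorem3p4 : ∀ {c ℓ₁ ℓ₂} (k : ℕ) .{{_ : NonZero k}} →
    ((F : FiniteField c ℓ₁ ℓ₂) (E : Subset (FiniteField.q F)) →
    ∣ E ∣ > FiniteField.q F * k /√ (FiniteField.q F ∸ 1) →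
    FiniteField.HasPowerDifference F k E)
    ×
    ((C : ℚ) → fromℕ k < C →
    ∃[ q₀ ] ((F : FiniteField c ℓ₁ ℓ₂) (E : Subset (FiniteField.q F)) →
    q₀ ≤ FiniteField.q F →
    ∣ E ∣ ≥ C √ FiniteField.q F →
    FiniteField.HasPowerDifference F k E))
theorem3p4 k = (λ F → large⇒powerDifference F k) , λ C k<C →
  let q₀ , threshold = √-threshold k C k<C in
  q₀ , λ F E q₀≤q ∣E∣≥C√q →
    large⇒powerDifference F k E (threshold ∣ E ∣ (FiniteField.q F) q₀≤q ∣E∣≥C√q)
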